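{- Let $n \ge 1$ be an integer, let $j \in \{1,\dots,2n\}$, and let $N = n^2 + j$. If the continued fraction of $\sqrt{N}$ has period of length $3$, then $j$ is an odd number and $\sqrt{N} = [n, \overline{x, x, 2n}]$, where $x$ is an even number.
   Context: The (simple) continued fraction expansion of an irrational real number $x$ is the unique infinite sequence $[a_0,a_1,a_2,\dots]$ with $a_0\in\mathbb Z$ and $a_i$ a positive integer for $i\ge 1$, such that the convergents $a_0+\cfrac{1}{a_1+\cfrac{1}{\ddots+\cfrac{1}{a_m}}}$ converge to $x$ as $m\to\infty$. The notation $[a_0,\dots,a_k,\overline{a_{k+1},\dots,a_\ell}]$ means that the block $a_{k+1},\dots,a_\ell$ is repeated infinitely many times after the preperiod $a_0,\dots,a_k$. For $N=n^2+j$ with $1\le j\le 2n$, the continued fraction of $\sqrt N$ has the form $[n,\overline{a_1,\dots,a_r,2n}]$. To say that it "has period of length $\ell$" means that it can be written in the form $[n,\overline{a_1,\dots,a_{\ell-1},2n}]$ with a repeating block of $\ell$ entries; the block is not required to be of minimal length. -}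

module Defs where

open import Data.Empty using (⊥)
open import Data.Integer.Base using (ℤ; +_)
open import Data.Nat.Base as ℕ using (ℕ; zero; suc)
open import Data.Nat.DivMod using (_mod_)
open import Data.Product using (∃; ∃-syntax; Σ-syntax; _×_; _,_)
open import Data.Rational.Base
open import Data.Rational.Properties
open import Data.Rational.Solver using (module +-*-Solver)
open import Data.Sum.Base using (_⊎_; inj₁; inj₂)
open import Data.Vec.Base using (Vec; lookup; _∷ʳ_)
open import Function.Base using (_∘_)
open import Relation.Binary.PropositionalEquality using (_≡_; refl; sym; trans; cong; subst; subst₂)
open import Relation.Nullary using (yes; no)

------------------------------------------------------------------------
-- Real numbers, as two-sided Dedekind cuts of ℚ

record ℝ : Set₁ where
  field
    Lower             : ℚ → Set        -- Lower q means q < x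
    Upper             : ℚ → Set        -- Upper q means x < q
    lower-inhabited   : ∃ Lower
    upper-inhabited   : ∃ Upper
    lower-closed      : ∀ {p q} → p < q → Lower q → Lower p
    upper-closed      : ∀ {p q} → p < q → Upper p → Upper q
    lower-open        : ∀ {p} → Lower p → ∃[ q ] p < q × Lower q
    upper-open        : ∀ {q} → Upper q → ∃[ p ] p < q × Upper p
    disjoint          : ∀ {q} → Lower q → Upper q → ⊥
    located           : ∀ {p q} → p < q → Lower p ⊎ Upper q

-- |c m - x| < ε is rendered as c m - ε < x < c m + ε.
ConvergesTo : (ℕ → ℚ) → ℝ → Set
ConvergesTo c x =
  ∀ (ε : ℚ) → 0ℚ < ε → ∃[ M ] (∀ m → M ℕ.≤ m → Lower (c m - ε) × Upper (c m + ε))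
  where open ℝ x

------------------------------------------------------------------------
-- The square root of a natural number

ℕ→ℚ : ℕ → ℚ
ℕ→ℚ n = + n / 1

BelowSqrt AboveSqrt : ℕ → ℚ → Set
BelowSqrt N q = q < 0ℚ ⊎ q * q < ℕ→ℚ N
AboveSqrt N q = 0ℚ < q × ℕ→ℚ N < q * q

private
  0≤ℕ : ∀ N → 0ℚ ≤ ℕ→ℚ N
  0≤ℕ N = nonNegative⁻¹ (ℕ→ℚ N) {{normalize-nonNeg N 1}}

  0<1 : 0ℚ < 1ℚ
  0<1 = positive⁻¹ 1ℚ

  sq-mono-≤ : ∀ {p q} → 0ℚ ≤ p → p ≤ q → p * p ≤ q * q
  sq-mono-≤ {p} {q} 0≤p p≤q = ≤-trans
    (*-monoʳ-≤-nonNeg p {{nonNegative 0≤p}} p≤q)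
    (*-monoˡ-≤-nonNeg q {{nonNegative (≤-trans 0≤p p≤q)}} p≤q)

  sq-mono-< : ∀ {p q} → 0ℚ ≤ p → p < q → p * p < q * q
  sq-mono-< {p} {q} 0≤p p<q = ≤-<-trans
    (*-monoʳ-≤-nonNeg p {{nonNegative 0≤p}} (<⇒≤ p<q))
    (*-monoʳ-<-pos q {{positive (≤-<-trans 0≤p p<q)}} p<q)

  sub-pos : ∀ {p q} → p < q → 0ℚ < q - p
  sub-pos {p} {q} p<q = subst (_< q - p) (+-inverseʳ p) (+-monoˡ-< (- p) p<q)

  pos-* : ∀ {p q} → 0ℚ < p → 0ℚ < q → 0ℚ < p * q
  pos-* {p} {q} 0<p 0<q =
    positive⁻¹ (p * q) {{pos*pos⇒pos p {{positive 0<p}} q {{positive 0<q}}}}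

  add-pos : ∀ {p q d} → 0ℚ < d → q ≡ p + d → p < q
  add-pos {p} {q} {d} 0<d eq =
    subst₂ _<_ (+-identityʳ p) (sym eq) (+-monoʳ-< p 0<d)

  -- For q ≥ 0, the point  r = ((A + 1) q + A) / (q + A + 1)  lies strictly between
  -- q and √A:  r - q = (A - q²) e  and  r² - A = (A² + A + 1) (q² - A) e²,
  -- where  e = 1 / (q + A + 1).
  module Mediant (A q : ℚ) (0≤A : 0ℚ ≤ A) (0≤q : 0ℚ ≤ q) where
    open +-*-Solver

    d : ℚ
    d = (q + A) + 1ℚ

    0<d : 0ℚ < d
    0<d = +-mono-≤-< (+-mono-≤ 0≤q 0≤A) 0<1

    instance
      d-pos : Positive d
      d-pos = positive 0<d
      d≢0 : NonZero d
      d≢0 = pos⇒nonZero d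

    e : ℚ
    e = 1/ d

    0<e : 0ℚ < e
    0<e = positive⁻¹ e {{1/pos⇒pos d}}

    r k : ℚ
    r = ((A + 1ℚ) * q + A) * e
    k = (A * A + A) + 1ℚ

    0<k : 0ℚ < k
    0<k = +-mono-≤-< (+-mono-≤ 0≤A² 0≤A) 0<1
      where
      0≤A² : 0ℚ ≤ A * A
      0≤A² = sq-mono-≤ ≤-refl 0≤A

    de : d * e ≡ 1ℚ
    de = *-inverseʳ d

    q-as : q ≡ (q * d) * e
    q-as = trans (sym (*-identityʳ q)) (trans (cong (q *_) (sym de)) (sym (*-assoc q d e)))

    A-as : A ≡ (A * (d * e)) * (d * e)
    A-as = trans (sym (*-identityʳ A))
      (trans (cong (A *_) (sym de))
      (trans (sym (*-identityʳ _)) (cong ((A * (d * e)) *_) (sym de))))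

    r-up : r ≡ q + (A - q * q) * e
    r-up = trans
      (solve 3 (λ a q e → ((a :+ con 1ℚ) :* q :+ a) :* e :=
        (q :* ((q :+ a) :+ con 1ℚ)) :* e :+ (a :+ :- (q :* q)) :* e) refl A q e)
      (cong (_+ (A - q * q) * e) (sym q-as))

    q-down : q ≡ r + (q * q - A) * e
    q-down = trans q-as
      (solve 3 (λ a q e → (q :* ((q :+ a) :+ con 1ℚ)) :* e :=
        ((a :+ con 1ℚ) :* q :+ a) :* e :+ (q :* q :+ :- a) :* e) refl A q e)

    A-up : A ≡ r * r + (k * (A - q * q)) * (e * e)
    A-up = trans A-as
      (solve 3 (λ a q e →
        let d = (q :+ a) :+ con 1ℚ
            r = ((a :+ con 1ℚ) :* q :+ a) :* e
            k = (a :* a :+ a) :+ con 1ℚ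
        in (a :* (d :* e)) :* (d :* e) := r :* r :+ (k :* (a :+ :- (q :* q))) :* (e :* e))
        refl A q e)

    r²-down : r * r ≡ A + (k * (q * q - A)) * (e * e)
    r²-down = trans
      (solve 3 (λ a q e →
        let d = (q :+ a) :+ con 1ℚ
            r = ((a :+ con 1ℚ) :* q :+ a) :* e
            k = (a :* a :+ a) :+ con 1ℚ
        in r :* r := (a :* (d :* e)) :* (d :* e) :+ (k :* (q :* q :+ :- a)) :* (e :* e))
        refl A q e)
      (cong (_+ (k * (q * q - A)) * (e * e)) (sym A-as))

    below : q * q < A → q < r × r * r < A
    below q²<A =
      add-pos (pos-* (sub-pos q²<A) 0<e) r-up ,
      add-pos (pos-* (pos-* 0<k (sub-pos q²<A)) (pos-* 0<e 0<e)) A-up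

    above : A < q * q → r < q × A < r * r
    above A<q² =
      add-pos (pos-* (sub-pos A<q²) 0<e) q-down ,
      add-pos (pos-* (pos-* 0<k (sub-pos A<q²)) (pos-* 0<e 0<e)) r²-down

    0<r : 0ℚ < q → 0ℚ < r
    0<r 0<q = pos-* (+-mono-<-≤ (pos-* (+-mono-≤-< 0≤A 0<1) 0<q) 0≤A) 0<e

  below-closed : ∀ N {p q} → p < q → BelowSqrt N q → BelowSqrt N p
  below-closed N p<q (inj₁ q<0) = inj₁ (<-trans p<q q<0)
  below-closed N {p} p<q (inj₂ q²<N) with p <? 0ℚ
  ... | yes p<0 = inj₁ p<0
  ... | no  p≮0 = inj₂ (<-trans (sq-mono-< (≮⇒≥ p≮0) p<q) q²<N)

  below-open : ∀ N {p} → BelowSqrt N p → ∃[ q ] p < q × BelowSqrt N q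
  below-open N (inj₁ p<0) = let (q , p<q , q<0) = <-dense p<0 in q , p<q , inj₁ q<0
  below-open N {p} (inj₂ p²<N) with p <? 0ℚ
  ... | yes p<0 = let (q , p<q , q<0) = <-dense p<0 in q , p<q , inj₁ q<0
  ... | no  p≮0 = let open Mediant (ℕ→ℚ N) p (0≤ℕ N) (≮⇒≥ p≮0)
                      (p<r , r²<N) = below p²<N
                  in r , p<r , inj₂ r²<N

  above-open : ∀ N {q} → AboveSqrt N q → ∃[ p ] p < q × AboveSqrt N p
  above-open N {q} (0<q , N<q²) =
    let open Mediant (ℕ→ℚ N) q (0≤ℕ N) (<⇒≤ 0<q)
        (r<q , N<r²) = above N<q²
    in r , r<q , 0<r 0<q , N<r²

  sqrt-disjoint : ∀ N {q} → BelowSqrt N q → AboveSqrt N q → ⊥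
  sqrt-disjoint N (inj₁ q<0)  (0<q , _)    = <-asym q<0 0<q
  sqrt-disjoint N (inj₂ q²<N) (_   , N<q²) = <-asym q²<N N<q²

  sqrt-located : ∀ N {p q} → p < q → BelowSqrt N p ⊎ AboveSqrt N q
  sqrt-located N {p} {q} p<q with p <? 0ℚ | ℕ→ℚ N <? q * q
  ... | yes p<0 | _        = inj₁ (inj₁ p<0)
  ... | no  p≮0 | yes N<q² = inj₂ (≤-<-trans (≮⇒≥ p≮0) p<q , N<q²)
  ... | no  p≮0 | no  N≮q² =
    inj₁ (inj₂ (<-≤-trans (sq-mono-< (≮⇒≥ p≮0) p<q) (≮⇒≥ N≮q²)))

  above-inhabited : ∀ N → AboveSqrt N (ℕ→ℚ N + 1ℚ)
  above-inhabited N = +-mono-≤-< (0≤ℕ N) 0<1 , add-pos 0<δ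
    (solve 1 (λ a → (a :+ con 1ℚ) :* (a :+ con 1ℚ) := a :+ ((a :* a :+ a) :+ con 1ℚ)) refl A)
    where
    open +-*-Solver
    A = ℕ→ℚ N
    0<δ : 0ℚ < (A * A + A) + 1ℚ
    0<δ = +-mono-≤-< (+-mono-≤ (sq-mono-≤ ≤-refl (0≤ℕ N)) (0≤ℕ N)) 0<1

√_ : ℕ → ℝ
√ N = record
  { Lower           = BelowSqrt N
  ; Upper           = AboveSqrt N
  ; lower-inhabited = - 1ℚ , inj₁ (negative⁻¹ (- 1ℚ))
  ; upper-inhabited = ℕ→ℚ N + 1ℚ , above-inhabited N
  ; lower-closed    = below-closed N
  ; upper-closed    = λ { p<q (0<p , N<p²) →
                          <-trans 0<p p<q , <-trans N<p² (sq-mono-< (<⇒≤ 0<p) p<q) }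
  ; lower-open      = below-open N
  ; upper-open      = above-open N
  ; disjoint        = sqrt-disjoint N
  ; located         = sqrt-located N
  }

------------------------------------------------------------------------
-- Simple continued fractions
--
-- An expansion [a₀, a₁, a₂, …] is given by a₀ : ℤ and a sequence a : ℕ → ℕ
-- of nonzero entries in which a i stands for a_{i+1}.

-- tailConvergent a _ m  =  a 0 + 1/(a 1 + 1/(⋯ + 1/a m))
tailConvergent     : (a : ℕ → ℕ) → .(∀ i → ℕ.NonZero (a i)) → ℕ → ℚ
tailConvergent-pos : (a : ℕ → ℕ) .(a≢0 : ∀ i → ℕ.NonZero (a i)) (m : ℕ) →
                     Positive (tailConvergent a a≢0 m)

tailConvergent-nonZero : (a : ℕ → ℕ) .(a≢0 : ∀ i → ℕ.NonZero (a i)) (m : ℕ) →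
                         NonZero (tailConvergent a a≢0 m)
tailConvergent-nonZero a a≢0 m =
  pos⇒nonZero (tailConvergent a a≢0 m) {{tailConvergent-pos a a≢0 m}}

tailConvergent a a≢0 zero    = ℕ→ℚ (a 0)
tailConvergent a a≢0 (suc m) =
  ℕ→ℚ (a 0) + (1/ tailConvergent (a ∘ suc) (a≢0 ∘ suc) m)
                {{tailConvergent-nonZero (a ∘ suc) (a≢0 ∘ suc) m}}

tailConvergent-pos a a≢0 zero    = normalize-pos (a 0) 1 {{_}} {{a≢0 0}}
tailConvergent-pos a a≢0 (suc m) =
  pos+pos⇒pos (ℕ→ℚ (a 0)) {{normalize-pos (a 0) 1 {{_}} {{a≢0 0}}}} _
    {{1/pos⇒pos (tailConvergent (a ∘ suc) (a≢0 ∘ suc) m)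
        {{tailConvergent-pos (a ∘ suc) (a≢0 ∘ suc) m}}}}

-- convergent a₀ a _ m  =  a₀ + 1/(a₁ + 1/(⋯ + 1/a_m))
convergent : ℤ → (a : ℕ → ℕ) → .(∀ i → ℕ.NonZero (a i)) → ℕ → ℚ
convergent a₀ a a≢0 zero    = a₀ / 1
convergent a₀ a a≢0 (suc m) =
  a₀ / 1 + (1/ tailConvergent a a≢0 m) {{tailConvergent-nonZero a a≢0 m}}

record IsContinuedFractionOf (x : ℝ) (a₀ : ℤ) (a : ℕ → ℕ) : Set where
  field
    nonzero   : ∀ i → ℕ.NonZero (a i)
    converges : ConvergesTo (convergent a₀ a nonzero) x

cycle : ∀ {k} → Vec ℕ (suc k) → ℕ → ℕ
cycle {k} block i = lookup block (i mod suc k)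

-- x ≐[ a₀ ⨾overline block ]  says that x = [a₀, \overline{block}].
_≐[_⨾overline_] : ∀ {k} → ℝ → ℤ → Vec ℕ (suc k) → Set
x ≐[ a₀ ⨾overline block ] = IsContinuedFractionOf x a₀ (cycle block)

-- √N = [n, \overline{a₁, …, a_{ℓ-1}, 2n}]  for some a₁, …, a_{ℓ-1}; the block
-- need not be of minimal length.
HasPeriodOfLength : (n N ℓ : ℕ) → .{{ℕ.NonZero ℓ}} → Set
HasPeriodOfLength n N ℓ =
  Σ[ as ∈ Vec ℕ (ℕ.pred ℓ) ] (√ N) ≐[ + n ⨾overline as ∷ʳ (2 ℕ.* n) ]

{-# OPTIONS --safe #-}

-- Write c_m for the convergents of √N = [n, \overline{a, b, 2n}].  Periodicity gives
--   (c_{m+3} − n) ((ab + 1)(c_m + n) + a) = b (c_m + n) + 1,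
-- and in the limit (a − b) √N + E = 0 with E = (ab + 1) j − ((a + b) n + 1), so that
-- (a − b)² N = E².  Since n² < N < (n + 1)², N is not a square, hence a = b and
-- (a² + 1) j = 2an + 1; thus j and a² + 1 are odd.
module Submission where

open import Defs
open import Data.Empty using (⊥-elim)
open import Data.Integer.Base as ℤ using (ℤ; +_)
import Data.Integer.Properties as ℤ
open import Data.Nat.Base as ℕ using (ℕ; zero; suc; _+_; _*_; _^_; _≤_; _<_)
open import Data.Nat.Coprimality using (coprime-divisor; coprime-/gcd)
open import Data.Nat.Divisibility
  using (_∣_; divides; ∣-refl; ∣-trans; ∣m∣n⇒∣m+n; ∣m+n∣m⇒∣n; ∣1⇒≡1; m∣m*n; n∣m*n; _∣0; *-monoˡ-∣; *-cancelʳ-∣)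
open import Data.Nat.DivMod using (_/_; m/n*n≡m)
open import Data.Nat.GCD using (gcd; gcd[m,n]∣m; gcd[m,n]∣n; gcd[m,n]≢0)
import Data.Nat.Properties as ℕ
import Data.Nat.Solver as ℕSolver
open import Data.Product using (∃-syntax; _×_; _,_; proj₁; proj₂)
open import Data.Rational.Base as ℚ using (ℚ; 0ℚ; 1ℚ; toℚᵘ)
import Data.Rational.Properties as ℚ
open import Algebra.Properties.Group ℚ.+-0-group using (⁻¹-involutive; x∙y⁻¹≈ε⇒x≈y)
open import Data.Rational.Solver using (module +-*-Solver)
open import Data.Rational.Unnormalised.Base as ℚᵘ using (mkℚᵘ; *≡*)
import Data.Rational.Unnormalised.Properties as ℚᵘ
open import Data.Sum.Base using (_⊎_; inj₁; inj₂; reduce)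
open import Data.Vec.Base using (_∷_; [])
open import Function.Base using (_∘_)
open import Relation.Binary.Definitions using (tri<; tri≈; tri>)
open import Relation.Binary.PropositionalEquality
  using (_≡_; refl; sym; trans; cong; cong₂; subst; subst₂; module ≡-Reasoning)
open import Relation.Nullary using (¬_; yes; no)

-- Squares and parity in ℕ

¬square-between : ∀ {n N} → n * n < N → N < suc n * suc n → ∀ r → ¬ (r * r ≡ N)
¬square-between {n} n²<N N<[1+n]² r refl with r ℕ.≤? n
... | yes r≤n = ℕ.<⇒≱ n²<N (ℕ.*-mono-≤ r≤n r≤n)
... | no  r≰n = ℕ.<⇒≱ N<[1+n]² (ℕ.*-mono-≤ (ℕ.≰⇒> r≰n) (ℕ.≰⇒> r≰n))

-- Dividing both numbers by `g = gcd m n` leaves coprime `m′` and `n′` with `m′ * m′ ∣ n′ * n′`.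
-- Then `m′` divides the product `n′ * n′`, hence `n′` by coprimality, and multiplying by `g`
-- restores the claim.
m²∣n²⇒m∣n : ∀ {m n} → m * m ∣ n * n → m ∣ n
m²∣n²⇒m∣n {zero} {zero}  _                 = ∣-refl
m²∣n²⇒m∣n {zero} {suc _} (divides q n²≡q*0) with () ← trans n²≡q*0 (ℕ.*-zeroʳ q)
m²∣n²⇒m∣n {m@(suc _)} {n} m²∣n² = subst₂ _∣_ m′g≡m n′g≡n (*-monoˡ-∣ g m′∣n′)
  where
  g = gcd m n
  instance
    g≢0 : ℕ.NonZero g
    g≢0 = ℕ.≢-nonZero (gcd[m,n]≢0 m n (inj₁ λ()))
    g²≢0 : ℕ.NonZero (g * g)
    g²≢0 = ℕ.m*n≢0 g g
  m′ = m / g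
  n′ = n / g
  m′g≡m : m′ * g ≡ m
  m′g≡m = m/n*n≡m (gcd[m,n]∣m m n)
  n′g≡n : n′ * g ≡ n
  n′g≡n = m/n*n≡m (gcd[m,n]∣n m n)
  square : ∀ k → (k * g) * (k * g) ≡ (k * k) * (g * g)
  square k = ℕ.[m*n]*[o*p]≡[m*o]*[n*p] k g k g
  m′²∣n′² : m′ * m′ ∣ n′ * n′
  m′²∣n′² = *-cancelʳ-∣ (g * g) (subst₂ _∣_
    (trans (cong₂ _*_ (sym m′g≡m) (sym m′g≡m)) (square m′))
    (trans (cong₂ _*_ (sym n′g≡n) (sym n′g≡n)) (square n′)) m²∣n²)
  m′∣n′ : m′ ∣ n′
  m′∣n′ = coprime-divisor (coprime-/gcd m n) (∣-trans (m∣m*n m′) m′²∣n′²)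

-- Irrationality of √N in integer form: if `m` were nonzero, then `m ∣ n`, say `n = r * m`, and
-- cancelling `m * m` would exhibit `N` as `r * r`.
m²N≡n²⇒m≡0 : ∀ {m n N} → (∀ r → ¬ (r * r ≡ N)) → m * m * N ≡ n * n → m ≡ 0
m²N≡n²⇒m≡0 {zero}        ¬square eq = refl
m²N≡n²⇒m≡0 {m@(suc _)} {n} {N} ¬square eq
  with divides r refl ← m²∣n²⇒m∣n {m} {n} (divides N (trans (sym eq) (ℕ.*-comm (m * m) N))) =
  ⊥-elim (¬square r (sym (ℕ.*-cancelˡ-≡ N (r * r) (m * m) (trans eq
    (trans (ℕ.[m*n]*[o*p]≡[m*o]*[n*p] r m r m) (ℕ.*-comm (r * r) (m * m)))))))

even-or-suc-even : ∀ n → 2 ∣ n ⊎ 2 ∣ suc n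
even-or-suc-even zero    = inj₁ (2 ∣0)
even-or-suc-even (suc n) with even-or-suc-even n
... | inj₁ 2∣n   = inj₂ (∣m∣n⇒∣m+n ∣-refl 2∣n)
... | inj₂ 2∣1+n = inj₁ 2∣1+n

-- The right side is odd, so every divisor of the left side is odd, in particular `j` and
-- `a * a + 1`. An odd `a` would make a² + 1 = (1 + a)² - 2a even.
[a²+1]j≡2an+1⇒parity : ∀ a j n → (a * a + 1) * j ≡ 2 * (a * n) + 1 → ¬ (2 ∣ j) × 2 ∣ a
[a²+1]j≡2an+1⇒parity a j n eq = odd (n∣m*n (a * a + 1)) , even
  where
  odd : ∀ {k} → k ∣ (a * a + 1) * j → ¬ (2 ∣ k)
  odd k∣ 2∣k with () ← ∣1⇒≡1 (∣m+n∣m⇒∣n (subst (2 ∣_) eq (∣-trans 2∣k k∣)) (m∣m*n (a * n)))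
  even : 2 ∣ a
  even with even-or-suc-even a
  ... | inj₁ 2∣a   = 2∣a
  ... | inj₂ 2∣1+a = ⊥-elim (odd (m∣m*n j) 2∣a²+1)
    where
    open ℕSolver.+-*-Solver
    [1+a]² : suc a * suc a ≡ 2 * a + (a * a + 1)
    [1+a]² = solve 1 (λ a → (con 1 :+ a) :* (con 1 :+ a) := con 2 :* a :+ (a :* a :+ con 1)) refl a
    2∣a²+1 : 2 ∣ a * a + 1
    2∣a²+1 = ∣m+n∣m⇒∣n (subst (2 ∣_) [1+a]² (∣-trans 2∣1+a (m∣m*n (suc a)))) (m∣m*n a)

-- The embedding of ℤ in ℚ

-- Since `_/_` normalises, the proof passes to unnormalised rationals, where fractions with
-- denominator 1 add by a direct computation; the next two lemmas go the same way.
/1-homo-+ : ∀ i k → (i ℤ.+ k) ℚ./ 1 ≡ i ℚ./ 1 ℚ.+ k ℚ./ 1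
/1-homo-+ i k = ℚ.toℚᵘ-injective (begin
  toℚᵘ ((i ℤ.+ k) ℚ./ 1)              ≈⟨ ℚ.toℚᵘ-fromℚᵘ (mkℚᵘ (i ℤ.+ k) 0) ⟩
  mkℚᵘ (i ℤ.+ k) 0                    ≈⟨ *≡* (cong (ℤ._* + 1) (cong₂ ℤ._+_ (sym (ℤ.*-identityʳ i)) (sym (ℤ.*-identityʳ k)))) ⟩
  mkℚᵘ i 0 ℚᵘ.+ mkℚᵘ k 0              ≈⟨ ℚᵘ.+-cong (ℚ.toℚᵘ-fromℚᵘ (mkℚᵘ i 0)) (ℚ.toℚᵘ-fromℚᵘ (mkℚᵘ k 0)) ⟨
  toℚᵘ (i ℚ./ 1) ℚᵘ.+ toℚᵘ (k ℚ./ 1)  ≈⟨ ℚ.toℚᵘ-homo-+ (i ℚ./ 1) (k ℚ./ 1) ⟨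
  toℚᵘ (i ℚ./ 1 ℚ.+ k ℚ./ 1)          ∎)
  where open ℚᵘ.≃-Reasoning

/1-homo-* : ∀ i k → (i ℤ.* k) ℚ./ 1 ≡ (i ℚ./ 1) ℚ.* (k ℚ./ 1)
/1-homo-* i k = ℚ.toℚᵘ-injective (begin
  toℚᵘ ((i ℤ.* k) ℚ./ 1)              ≈⟨ ℚ.toℚᵘ-fromℚᵘ (mkℚᵘ (i ℤ.* k) 0) ⟩
  mkℚᵘ i 0 ℚᵘ.* mkℚᵘ k 0              ≈⟨ ℚᵘ.*-cong (ℚ.toℚᵘ-fromℚᵘ (mkℚᵘ i 0)) (ℚ.toℚᵘ-fromℚᵘ (mkℚᵘ k 0)) ⟨
  toℚᵘ (i ℚ./ 1) ℚᵘ.* toℚᵘ (k ℚ./ 1)  ≈⟨ ℚ.toℚᵘ-homo-* (i ℚ./ 1) (k ℚ./ 1) ⟨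
  toℚᵘ ((i ℚ./ 1) ℚ.* (k ℚ./ 1))      ∎)
  where open ℚᵘ.≃-Reasoning

/1-homo-neg : ∀ i → (ℤ.- i) ℚ./ 1 ≡ ℚ.- (i ℚ./ 1)
/1-homo-neg i = ℚ.toℚᵘ-injective (begin
  toℚᵘ ((ℤ.- i) ℚ./ 1)   ≈⟨ ℚ.toℚᵘ-fromℚᵘ (mkℚᵘ (ℤ.- i) 0) ⟩
  ℚᵘ.- mkℚᵘ i 0          ≈⟨ ℚᵘ.-‿cong (ℚ.toℚᵘ-fromℚᵘ (mkℚᵘ i 0)) ⟨
  ℚᵘ.- toℚᵘ (i ℚ./ 1)    ≈⟨ ℚ.toℚᵘ-homo‿- (i ℚ./ 1) ⟨
  toℚᵘ (ℚ.- (i ℚ./ 1))   ∎)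
  where open ℚᵘ.≃-Reasoning

/1-homo-- : ∀ i k → (i ℤ.- k) ℚ./ 1 ≡ i ℚ./ 1 ℚ.- k ℚ./ 1
/1-homo-- i k = trans (/1-homo-+ i (ℤ.- k)) (cong (i ℚ./ 1 ℚ.+_) (/1-homo-neg k))

/1-injective : ∀ {i k} → i ℚ./ 1 ≡ k ℚ./ 1 → i ≡ k
/1-injective {i} {k} eq with *≡* i*1≡k*1 ← ℚ./-injective-≃ (mkℚᵘ i 0) (mkℚᵘ k 0) eq =
  subst₂ _≡_ (ℤ.*-identityʳ i) (ℤ.*-identityʳ k) i*1≡k*1

ℕ→ℚ-homo-+ : ∀ m n → ℕ→ℚ (m + n) ≡ ℕ→ℚ m ℚ.+ ℕ→ℚ n
ℕ→ℚ-homo-+ m n = /1-homo-+ (+ m) (+ n)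

ℕ→ℚ-homo-* : ∀ m n → ℕ→ℚ (m * n) ≡ ℕ→ℚ m ℚ.* ℕ→ℚ n
ℕ→ℚ-homo-* m n = trans (cong (ℚ._/ 1) (ℤ.pos-* m n)) (/1-homo-* (+ m) (+ n))

-- Families of rationals indexed by a tolerance

-- The cap `ε≤1` keeps rationals within the tolerance of √N uniformly bounded and lets ε² be
-- absorbed into a multiple of ε.
record Tolerance : Set where
  field
    ε   : ℚ
    0<ε : 0ℚ ℚ.< ε
    ε≤1 : ε ℚ.≤ 1ℚ

  instance
    ε-nonNegative : ℚ.NonNegative ε
    ε-nonNegative = ℚ.nonNegative (ℚ.<⇒≤ 0<ε)

open Tolerance

-- `Bounded` and `Negligible` are O(1) and O(ε), with constants uniform in the tolerance. They allow
-- passing to the limit without arithmetic on `ℝ`.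
Bounded : (Tolerance → ℚ) → Set
Bounded f = ∃[ B ] (∀ t → ℚ.∣ f t ∣ ℚ.≤ B)

Negligible : (Tolerance → ℚ) → Set
Negligible f = ∃[ K ] (∀ t → ℚ.∣ f t ∣ ℚ.≤ K ℚ.* ε t)

∣p*q∣≤ : ∀ {p q B C} → ℚ.∣ p ∣ ℚ.≤ B → ℚ.∣ q ∣ ℚ.≤ C → ℚ.∣ p ℚ.* q ∣ ℚ.≤ B ℚ.* C
∣p*q∣≤ {p} {q} {B} {C} ∣p∣≤B ∣q∣≤C = begin
  ℚ.∣ p ℚ.* q ∣          ≡⟨ ℚ.∣p*q∣≡∣p∣*∣q∣ p q ⟩
  ℚ.∣ p ∣ ℚ.* ℚ.∣ q ∣    ≤⟨ ℚ.*-monoʳ-≤-nonNeg ℚ.∣ q ∣ {{ℚ.∣-∣-nonNeg q}} ∣p∣≤B ⟩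
  B ℚ.* ℚ.∣ q ∣          ≤⟨ ℚ.*-monoˡ-≤-nonNeg B {{ℚ.nonNegative (ℚ.≤-trans (ℚ.0≤∣p∣ p) ∣p∣≤B)}} ∣q∣≤C ⟩
  B ℚ.* C                ∎
  where open ℚ.≤-Reasoning

∣p+q∣≤ : ∀ {p q B C} → ℚ.∣ p ∣ ℚ.≤ B → ℚ.∣ q ∣ ℚ.≤ C → ℚ.∣ p ℚ.+ q ∣ ℚ.≤ B ℚ.+ C
∣p+q∣≤ {p} {q} ∣p∣≤B ∣q∣≤C = ℚ.≤-trans (ℚ.∣p+q∣≤∣p∣+∣q∣ p q) (ℚ.+-mono-≤ ∣p∣≤B ∣q∣≤C)

bounded-const : ∀ p → Bounded (λ _ → p)
bounded-const p = ℚ.∣ p ∣ , λ _ → ℚ.≤-refl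

bounded-+ : ∀ {f g} → Bounded f → Bounded g → Bounded (λ t → f t ℚ.+ g t)
bounded-+ (B , f≤B) (C , g≤C) = B ℚ.+ C , λ t → ∣p+q∣≤ (f≤B t) (g≤C t)

bounded-* : ∀ {f g} → Bounded f → Bounded g → Bounded (λ t → f t ℚ.* g t)
bounded-* (B , f≤B) (C , g≤C) = B ℚ.* C , λ t → ∣p*q∣≤ (f≤B t) (g≤C t)

bounded-neg : ∀ {f} → Bounded f → Bounded (λ t → ℚ.- f t)
bounded-neg {f} (B , f≤B) = B , λ t → subst (ℚ._≤ B) (sym (ℚ.∣-p∣≡∣p∣ (f t))) (f≤B t)

negligible-+ : ∀ {f g} → Negligible f → Negligible g → Negligible (λ t → f t ℚ.+ g t)
negligible-+ {f} {g} (K , f≤Kε) (L , g≤Lε) = K ℚ.+ L , λ t →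
  subst (ℚ.∣ f t ℚ.+ g t ∣ ℚ.≤_) (sym (ℚ.*-distribʳ-+ (ε t) K L)) (∣p+q∣≤ (f≤Kε t) (g≤Lε t))

bounded*negligible : ∀ {f g} → Bounded f → Negligible g → Negligible (λ t → f t ℚ.* g t)
bounded*negligible {f} {g} (B , f≤B) (K , g≤Kε) = B ℚ.* K , λ t →
  subst (ℚ.∣ f t ℚ.* g t ∣ ℚ.≤_) (sym (ℚ.*-assoc B K (ε t))) (∣p*q∣≤ (f≤B t) (g≤Kε t))

negligible-const⇒≡0 : ∀ p → Negligible (λ _ → p) → p ≡ 0ℚ
negligible-const⇒≡0 p (K , p≤Kε) with ℚ.∣ p ∣ ℚ.≤? 0ℚ
... | yes ∣p∣≤0 = ℚ.∣p∣≡0⇒p≡0 p (ℚ.≤-antisym ∣p∣≤0 (ℚ.0≤∣p∣ p))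
... | no  ∣p∣≰0 = ⊥-elim (ℚ.<-irrefl refl (ℚ.<-≤-trans Kε<x (p≤Kε tolerance)))
  where
  x = ℚ.∣ p ∣
  0<x : 0ℚ ℚ.< x
  0<x = ℚ.≰⇒> ∣p∣≰0
  -- The largest tolerance, 1, already shows that `K` is positive.
  x≤K : x ℚ.≤ K
  x≤K = subst (x ℚ.≤_) (ℚ.*-identityʳ K)
    (p≤Kε (record { ε = 1ℚ ; 0<ε = ℚ.positive⁻¹ 1ℚ ; ε≤1 = ℚ.≤-refl }))
  0<K : 0ℚ ℚ.< K
  0<K = ℚ.<-≤-trans 0<x x≤K
  d = K ℚ.+ x
  instance
    x-pos : ℚ.Positive x
    x-pos = ℚ.positive 0<x
    d-pos : ℚ.Positive d
    d-pos = ℚ.positive (ℚ.+-mono-< 0<K 0<x)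
    d≢0 : ℚ.NonZero d
    d≢0 = ℚ.pos⇒nonZero d
    1/d-pos : ℚ.Positive (ℚ.1/ d)
    1/d-pos = ℚ.1/pos⇒pos d
  -- With e = x / (K + x), the product K e falls short of x by exactly e x > 0, and K > 0 gives e ≤
  -- 1.
  e = x ℚ.* ℚ.1/ d
  instance
    e-pos : ℚ.Positive e
    e-pos = ℚ.pos*pos⇒pos x (ℚ.1/ d)
  ed≡x : e ℚ.* d ≡ x
  ed≡x = trans (ℚ.*-assoc x (ℚ.1/ d) d) (trans (cong (x ℚ.*_) (ℚ.*-inverseˡ d)) (ℚ.*-identityʳ x))
  e≤1 : e ℚ.≤ 1ℚ
  e≤1 = ℚ.*-cancelʳ-≤-pos d (begin
    e ℚ.* d     ≡⟨ ed≡x ⟩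
    x           ≡⟨ ℚ.+-identityˡ x ⟨
    0ℚ ℚ.+ x    ≤⟨ ℚ.+-monoˡ-≤ x (ℚ.<⇒≤ 0<K) ⟩
    d           ≡⟨ ℚ.*-identityˡ d ⟨
    1ℚ ℚ.* d    ∎)
    where open ℚ.≤-Reasoning
  tolerance : Tolerance
  tolerance = record { ε = e ; 0<ε = ℚ.positive⁻¹ e ; ε≤1 = e≤1 }
  Kε<x : K ℚ.* e ℚ.< x
  Kε<x = begin-strict
    K ℚ.* e                ≡⟨ ℚ.+-identityʳ (K ℚ.* e) ⟨
    K ℚ.* e ℚ.+ 0ℚ         <⟨ ℚ.+-monoʳ-< (K ℚ.* e) (ℚ.positive⁻¹ (e ℚ.* x) {{ℚ.pos*pos⇒pos e x}}) ⟩
    K ℚ.* e ℚ.+ e ℚ.* x    ≡⟨ cong (ℚ._+ e ℚ.* x) (ℚ.*-comm K e) ⟩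
    e ℚ.* K ℚ.+ e ℚ.* x    ≡⟨ ℚ.*-distribˡ-+ e K x ⟨
    e ℚ.* d                ≡⟨ ed≡x ⟩
    x                      ∎
    where open ℚ.≤-Reasoning

-- Rationals within a tolerance of a real number

Near : ℝ → ℚ → ℚ → Set
Near x ε c = ℝ.Lower x (c ℚ.- ε) × ℝ.Upper x (c ℚ.+ ε)

lower<upper : ∀ x {p q} → ℝ.Lower x p → ℝ.Upper x q → p ℚ.< q
lower<upper x {p} {q} lower upper with ℚ.<-cmp p q
... | tri< p<q _    _   = p<q
... | tri≈ _   refl _   = ⊥-elim (ℝ.disjoint x lower upper)
... | tri> _   _    q<p = ⊥-elim (ℝ.disjoint x (ℝ.lower-closed x q<p lower) upper)

p-r<q⇒p<q+r : ∀ {p q} r → p ℚ.- r ℚ.< q → p ℚ.< q ℚ.+ r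
p-r<q⇒p<q+r {p} {q} r p-r<q = subst (ℚ._< q ℚ.+ r)
  (solve 2 (λ p r → (p :- r) :+ r := p) refl p r) (ℚ.+-monoˡ-< r p-r<q)
  where open +-*-Solver

p≤∣p∣ : ∀ p → p ℚ.≤ ℚ.∣ p ∣
p≤∣p∣ p with ℚ.≤-total 0ℚ p
... | inj₁ 0≤p = ℚ.≤-reflexive (sym (ℚ.0≤p⇒∣p∣≡p 0≤p))
... | inj₂ p≤0 = ℚ.≤-trans p≤0 (ℚ.0≤∣p∣ p)

-p≤q≤p⇒∣q∣≤p : ∀ {p q} → ℚ.- p ℚ.≤ q → q ℚ.≤ p → ℚ.∣ q ∣ ℚ.≤ p
-p≤q≤p⇒∣q∣≤p {p} {q} -p≤q q≤p with ℚ.∣p∣≡p∨∣p∣≡-p q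
... | inj₁ ∣q∣≡q  = subst (ℚ._≤ p) (sym ∣q∣≡q) q≤p
... | inj₂ ∣q∣≡-q = subst₂ ℚ._≤_ (sym ∣q∣≡-q) (⁻¹-involutive p) (ℚ.neg-antimono-≤ -p≤q)

p≤q+r⇒p-q≤r : ∀ {p q r} → p ℚ.≤ q ℚ.+ r → p ℚ.- q ℚ.≤ r
p≤q+r⇒p-q≤r {p} {q} {r} p≤q+r = subst (p ℚ.- q ℚ.≤_)
  (solve 2 (λ q r → (q :+ r) :- q := r) refl q r) (ℚ.+-monoˡ-≤ (ℚ.- q) p≤q+r)
  where open +-*-Solver

∣p-q∣≤r : ∀ {p q r} → p ℚ.≤ q ℚ.+ r → q ℚ.≤ p ℚ.+ r → ℚ.∣ p ℚ.- q ∣ ℚ.≤ r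
∣p-q∣≤r {p} {q} {r} p≤q+r q≤p+r = -p≤q≤p⇒∣q∣≤p
  (subst (ℚ.- r ℚ.≤_) (solve 2 (λ p q → :- (q :- p) := p :- q) refl p q)
    (ℚ.neg-antimono-≤ (p≤q+r⇒p-q≤r q≤p+r)))
  (p≤q+r⇒p-q≤r p≤q+r)
  where open +-*-Solver

-- From p - ε < x < q + ε follows p < q + 2ε, and the same with `p` and `q` exchanged.
near-near : ∀ x {ε p q} → Near x ε p → Near x ε q → ℚ.∣ p ℚ.- q ∣ ℚ.≤ (1ℚ ℚ.+ 1ℚ) ℚ.* ε
near-near x {ε} {p} {q} (p-ε<x , x<p+ε) (q-ε<x , x<q+ε) = ∣p-q∣≤r {p} {q}
  (ordered p q p-ε<x x<q+ε) (ordered q p q-ε<x x<p+ε)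
  where
  open +-*-Solver
  ordered : ∀ p q → ℝ.Lower x (p ℚ.- ε) → ℝ.Upper x (q ℚ.+ ε) → p ℚ.≤ q ℚ.+ (1ℚ ℚ.+ 1ℚ) ℚ.* ε
  ordered p q l u = ℚ.<⇒≤ (subst (p ℚ.<_)
    (solve 2 (λ q e → (q :+ e) :+ e := q :+ (con 1ℚ :+ con 1ℚ) :* e) refl q ε)
    (p-r<q⇒p<q+r ε (lower<upper x l u)))

-- Rationals within a tolerance of √N

module NearSqrt (N : ℕ) where

  -- In `B`, N + 1 is the upper bound of √N from `upper-inhabited`, and the last 1 absorbs the
  -- tolerance. `K` dominates the factors 2c + ε and 2c - ε that arise when (c + ε)² and (c - ε)²
  -- are compared with c².
  B K : ℚ
  B = (ℕ→ℚ N ℚ.+ 1ℚ) ℚ.+ 1ℚ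
  K = (B ℚ.+ B) ℚ.+ 1ℚ

  instance
    N-nonNeg : ℚ.NonNegative (ℕ→ℚ N)
    N-nonNeg = ℚ.normalize-nonNeg N 1
    B-nonNeg : ℚ.NonNegative B
    B-nonNeg = ℚ.nonNeg+nonNeg⇒nonNeg (ℕ→ℚ N ℚ.+ 1ℚ) {{ℚ.nonNeg+nonNeg⇒nonNeg (ℕ→ℚ N) 1ℚ}} 1ℚ
    B+B-nonNeg : ℚ.NonNegative (B ℚ.+ B)
    B+B-nonNeg = ℚ.nonNeg+nonNeg⇒nonNeg B B

  1≤K : 1ℚ ℚ.≤ K
  1≤K = ℚ.≤-trans (ℚ.≤-reflexive (sym (ℚ.+-identityˡ 1ℚ)))
    (ℚ.+-monoˡ-≤ 1ℚ (ℚ.nonNegative⁻¹ (B ℚ.+ B)))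

  1≤B : 1ℚ ℚ.≤ B
  1≤B = ℚ.≤-trans (ℚ.≤-reflexive (sym (ℚ.+-identityˡ 1ℚ)))
    (ℚ.+-monoˡ-≤ 1ℚ (ℚ.nonNegative⁻¹ (ℕ→ℚ N ℚ.+ 1ℚ) {{ℚ.nonNeg+nonNeg⇒nonNeg (ℕ→ℚ N) 1ℚ}}))

  module _ (t : Tolerance) {c : ℚ} where

    -ε<c : AboveSqrt N (c ℚ.+ ε t) → ℚ.- ε t ℚ.< c
    -ε<c (0<c+ε , _) = subst₂ ℚ._<_ (ℚ.+-identityˡ (ℚ.- ε t))
      (solve 2 (λ c e → (c :+ e) :- e := c) refl c (ε t)) (ℚ.+-monoˡ-< (ℚ.- ε t) 0<c+ε)
      where open +-*-Solver

    -- Below, c > -ε ≥ -1 because the upper cut of √N contains only positive rationals; above, c < N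
    -- + 1 + ε.
    bound : Near (√ N) (ε t) c → ℚ.∣ c ∣ ℚ.≤ B
    bound (lower , upper) = -p≤q≤p⇒∣q∣≤p
      (ℚ.≤-trans (ℚ.neg-antimono-≤ (ℚ.≤-trans (ε≤1 t) 1≤B)) (ℚ.<⇒≤ (-ε<c upper)))
      (ℚ.≤-trans (ℚ.<⇒≤ (p-r<q⇒p<q+r (ε t) (lower<upper (√ N) lower (proj₂ (ℝ.upper-inhabited (√ N))))))
        (ℚ.+-monoʳ-≤ (ℕ→ℚ N ℚ.+ 1ℚ) (ε≤1 t)))

    c≤B : Near (√ N) (ε t) c → c ℚ.≤ B
    c≤B near = ℚ.≤-trans (p≤∣p∣ c) (bound near)

    square-bound : Near (√ N) (ε t) c → ℚ.∣ c ℚ.* c ℚ.- ℕ→ℚ N ∣ ℚ.≤ K ℚ.* ε t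
    square-bound near@(lower , upper@(_ , N<[c+ε]²)) = ∣p-q∣≤r (c²≤ lower) N≤
      where
      open ℚ.≤-Reasoning
      open +-*-Solver
      ε-small : ε t ℚ.≤ K ℚ.* ε t
      ε-small = subst (ℚ._≤ K ℚ.* ε t) (ℚ.*-identityˡ (ε t))
        (ℚ.*-monoʳ-≤-nonNeg (ε t) {{ε-nonNegative t}} 1≤K)
      N≤ : ℕ→ℚ N ℚ.≤ c ℚ.* c ℚ.+ K ℚ.* ε t
      N≤ = begin
        ℕ→ℚ N                                        ≤⟨ ℚ.<⇒≤ N<[c+ε]² ⟩
        (c ℚ.+ ε t) ℚ.* (c ℚ.+ ε t)                  ≡⟨ solve 2 (λ c e → (c :+ e) :* (c :+ e) := c :* c :+ ((c :+ c) :+ e) :* e) refl c (ε t) ⟩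
        c ℚ.* c ℚ.+ ((c ℚ.+ c) ℚ.+ ε t) ℚ.* ε t      ≤⟨ ℚ.+-monoʳ-≤ (c ℚ.* c) (ℚ.*-monoʳ-≤-nonNeg (ε t) {{ε-nonNegative t}}
                                                          (ℚ.+-mono-≤ (ℚ.+-mono-≤ (c≤B near) (c≤B near)) (ε≤1 t))) ⟩
        c ℚ.* c ℚ.+ K ℚ.* ε t                        ∎
      -ε≤1 : ℚ.- ε t ℚ.≤ 1ℚ
      -ε≤1 = ℚ.≤-trans (ℚ.<⇒≤ (ℚ.neg-antimono-< (0<ε t))) (ℚ.nonNegative⁻¹ 1ℚ)
      c²≤ : BelowSqrt N (c ℚ.- ε t) → c ℚ.* c ℚ.≤ ℕ→ℚ N ℚ.+ K ℚ.* ε t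
      -- A negative c - ε lies below √N without any information on its square. But then |c| ≤ ε, so
      -- c² ≤ ε already.
      c²≤ (inj₁ c-ε<0) = begin
        c ℚ.* c                  ≤⟨ p≤∣p∣ (c ℚ.* c) ⟩
        ℚ.∣ c ℚ.* c ∣            ≤⟨ ∣p*q∣≤ ∣c∣≤ε (ℚ.≤-trans ∣c∣≤ε (ε≤1 t)) ⟩
        ε t ℚ.* 1ℚ               ≡⟨ ℚ.*-identityʳ (ε t) ⟩
        ε t                      ≤⟨ ε-small ⟩
        K ℚ.* ε t                ≡⟨ ℚ.+-identityˡ (K ℚ.* ε t) ⟨
        0ℚ ℚ.+ K ℚ.* ε t         ≤⟨ ℚ.+-monoˡ-≤ (K ℚ.* ε t) (ℚ.nonNegative⁻¹ (ℕ→ℚ N)) ⟩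
        ℕ→ℚ N ℚ.+ K ℚ.* ε t      ∎
        where
        ∣c∣≤ε : ℚ.∣ c ∣ ℚ.≤ ε t
        ∣c∣≤ε = -p≤q≤p⇒∣q∣≤p (ℚ.<⇒≤ (-ε<c upper))
          (subst (c ℚ.≤_) (ℚ.+-identityˡ (ε t)) (ℚ.<⇒≤ (p-r<q⇒p<q+r (ε t) c-ε<0)))
      c²≤ (inj₂ [c-ε]²<N) = begin
        c ℚ.* c                                                         ≡⟨ solve 2 (λ c e → c :* c := (c :- e) :* (c :- e) :+ ((c :+ c) :- e) :* e) refl c (ε t) ⟩
        (c ℚ.- ε t) ℚ.* (c ℚ.- ε t) ℚ.+ ((c ℚ.+ c) ℚ.- ε t) ℚ.* ε t     ≤⟨ ℚ.+-mono-≤ (ℚ.<⇒≤ [c-ε]²<N) (ℚ.*-monoʳ-≤-nonNeg (ε t) {{ε-nonNegative t}}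
                                                                             (ℚ.+-mono-≤ (ℚ.+-mono-≤ (c≤B near) (c≤B near)) -ε≤1)) ⟩
        ℕ→ℚ N ℚ.+ K ℚ.* ε t                                             ∎

-- The limit of the recurrence for convergents

-- The hypotheses encode r = 1/(α + 1/(β + 1/t)), with `p` and `q` the inner reciprocals. The
-- conclusion is r = (βt + 1)/((αβ + 1)t + α) without division, obtained by substituting the
-- hypotheses for occurrences of 1.
inverses⇒möbius : ∀ {α β t p q r} → p ℚ.* t ≡ 1ℚ → q ℚ.* (β ℚ.+ p) ≡ 1ℚ → r ℚ.* (α ℚ.+ q) ≡ 1ℚ →
                  r ℚ.* ((α ℚ.* β ℚ.+ 1ℚ) ℚ.* t ℚ.+ α) ≡ β ℚ.* t ℚ.+ 1ℚ
inverses⇒möbius {α} {β} {t} {p} {q} {r} pt≡1 qw≡1 rs≡1 = begin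
  r ℚ.* ((α ℚ.* β ℚ.+ 1ℚ) ℚ.* t ℚ.+ α)
    ≡⟨ solve 4 (λ α β t r → r :* ((α :* β :+ con 1ℚ) :* t :+ α) :=
         r :* ((α :* β :* t :+ α :* con 1ℚ) :+ con 1ℚ :* t)) refl α β t r ⟩
  r ℚ.* ((α ℚ.* β ℚ.* t ℚ.+ α ℚ.* 1ℚ) ℚ.+ 1ℚ ℚ.* t)
    ≡⟨ cong₂ (λ x y → r ℚ.* ((α ℚ.* β ℚ.* t ℚ.+ α ℚ.* x) ℚ.+ y ℚ.* t)) (sym pt≡1) (sym qw≡1) ⟩
  r ℚ.* ((α ℚ.* β ℚ.* t ℚ.+ α ℚ.* (p ℚ.* t)) ℚ.+ (q ℚ.* (β ℚ.+ p)) ℚ.* t)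
    ≡⟨ solve 6 (λ α β t p q r →
         r :* ((α :* β :* t :+ α :* (p :* t)) :+ (q :* (β :+ p)) :* t) :=
         (r :* (α :+ q)) :* (β :* t :+ p :* t)) refl α β t p q r ⟩
  (r ℚ.* (α ℚ.+ q)) ℚ.* (β ℚ.* t ℚ.+ p ℚ.* t)
    ≡⟨ cong₂ (λ x y → x ℚ.* (β ℚ.* t ℚ.+ y)) rs≡1 pt≡1 ⟩
  1ℚ ℚ.* (β ℚ.* t ℚ.+ 1ℚ)
    ≡⟨ ℚ.*-identityˡ _ ⟩
  β ℚ.* t ℚ.+ 1ℚ ∎
  where
  open ≡-Reasoning
  open +-*-Solver

module Limit (α β ν ι : ℚ) where

  -- `ν` and `ι` stand for n and j, so `M` is N. At a fixed point c = ν + r with c² = M the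
  -- recurrence collapses to D c + E = 0.
  D E M : ℚ
  D = α ℚ.- β
  M = ν ℚ.* ν ℚ.+ ι
  E = (α ℚ.* β ℚ.+ 1ℚ) ℚ.* ι ℚ.- ((α ℚ.+ β) ℚ.* ν ℚ.+ 1ℚ)

  -- D² M − E² = −D² (c² − M) + (D c − E)(D c + E), and the recurrence expresses D c + E
  -- through c² − M and the step (ν + r) − c.
  D²M-E² : ∀ {c r} → r ℚ.* ((α ℚ.* β ℚ.+ 1ℚ) ℚ.* (ν ℚ.+ c) ℚ.+ α) ≡ β ℚ.* (ν ℚ.+ c) ℚ.+ 1ℚ →
    let L = D ℚ.* c ℚ.+ ℚ.- E in
    D ℚ.* D ℚ.* M ℚ.- E ℚ.* E ≡
      (ℚ.- (D ℚ.* D ℚ.+ L ℚ.* (α ℚ.* β ℚ.+ 1ℚ))) ℚ.* (c ℚ.* c ℚ.- M) ℚ.+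
      (ℚ.- (L ℚ.* ((α ℚ.* β ℚ.+ 1ℚ) ℚ.* (ν ℚ.+ c) ℚ.+ α))) ℚ.* ((ν ℚ.+ r) ℚ.- c)
  D²M-E² {c} {r} möbius = begin
    D ℚ.* D ℚ.* M ℚ.- E ℚ.* E
      ≡⟨ solve 6 (λ α β ν ι c r →
           let D = α :- β
               M = ν :* ν :+ ι
               A = α :* β :+ con 1ℚ
               E = A :* ι :- ((α :+ β) :* ν :+ con 1ℚ)
               L = D :* c :+ :- E
               G = A :* (ν :+ c) :+ α
           in D :* D :* M :- E :* E :=
                ((:- (D :* D :+ L :* A)) :* (c :* c :- M) :+ (:- (L :* G)) :* ((ν :+ r) :- c)) :+
                L :* (r :* G :- (β :* (ν :+ c) :+ con 1ℚ))) refl α β ν ι c r ⟩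
    rest ℚ.+ L ℚ.* (r ℚ.* ((α ℚ.* β ℚ.+ 1ℚ) ℚ.* (ν ℚ.+ c) ℚ.+ α) ℚ.- (β ℚ.* (ν ℚ.+ c) ℚ.+ 1ℚ))
      ≡⟨ cong (λ x → rest ℚ.+ L ℚ.* (x ℚ.- (β ℚ.* (ν ℚ.+ c) ℚ.+ 1ℚ))) möbius ⟩
    rest ℚ.+ L ℚ.* ((β ℚ.* (ν ℚ.+ c) ℚ.+ 1ℚ) ℚ.- (β ℚ.* (ν ℚ.+ c) ℚ.+ 1ℚ))
      ≡⟨ solve 3 (λ x l y → x :+ l :* (y :- y) := x) refl rest L (β ℚ.* (ν ℚ.+ c) ℚ.+ 1ℚ) ⟩
    rest ∎
    where
    open ≡-Reasoning
    open +-*-Solver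
    L = D ℚ.* c ℚ.+ ℚ.- E
    rest = (ℚ.- (D ℚ.* D ℚ.+ L ℚ.* (α ℚ.* β ℚ.+ 1ℚ))) ℚ.* (c ℚ.* c ℚ.- M) ℚ.+
      (ℚ.- (L ℚ.* ((α ℚ.* β ℚ.+ 1ℚ) ℚ.* (ν ℚ.+ c) ℚ.+ α))) ℚ.* ((ν ℚ.+ r) ℚ.- c)

  -- The difference of the two sides does not depend on the tolerance, yet `D²M-E²` writes it as a
  -- sum of bounded multiples of negligible terms; hence it is 0.
  D²M≡E² : (c r : Tolerance → ℚ) → Bounded c →
    Negligible (λ t → c t ℚ.* c t ℚ.- M) → Negligible (λ t → (ν ℚ.+ r t) ℚ.- c t) →
    (∀ t → r t ℚ.* ((α ℚ.* β ℚ.+ 1ℚ) ℚ.* (ν ℚ.+ c t) ℚ.+ α) ≡ β ℚ.* (ν ℚ.+ c t) ℚ.+ 1ℚ) →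
    D ℚ.* D ℚ.* M ≡ E ℚ.* E
  D²M≡E² c r bc nsq nstep möbius = x∙y⁻¹≈ε⇒x≈y _ _ (negligible-const⇒≡0 _
    (proj₁ combination , λ t → subst (λ x → ℚ.∣ x ∣ ℚ.≤ proj₁ combination ℚ.* ε t)
      (sym (D²M-E² (möbius t))) (proj₂ combination t)))
    where
    A = α ℚ.* β ℚ.+ 1ℚ
    bL : Bounded (λ t → D ℚ.* c t ℚ.+ ℚ.- E)
    bL = bounded-+ (bounded-* (bounded-const D) bc) (bounded-const (ℚ.- E))
    bG : Bounded (λ t → A ℚ.* (ν ℚ.+ c t) ℚ.+ α)
    bG = bounded-+ (bounded-* (bounded-const A) (bounded-+ (bounded-const ν) bc)) (bounded-const α)
    combination = negligible-+
      (bounded*negligible (bounded-neg (bounded-+ (bounded-const (D ℚ.* D)) (bounded-* bL (bounded-const A)))) nsq)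
      (bounded*negligible (bounded-neg (bounded-* bL bG)) nstep)


-- The recurrence for a block of three entries and its integer consequence

module PeriodThree (n a b : ℕ) (nonzero : ∀ i → ℕ.NonZero (cycle (a ∷ b ∷ 2 * n ∷ []) i)) where

  entries : ℕ → ℕ
  entries = cycle (a ∷ b ∷ 2 * n ∷ [])

  c : ℕ → ℚ
  c = convergent (+ n) entries nonzero

  -- With the shift written as `k + i`, for a numeral `k` the reciprocal in `tail k (suc m)` is
  -- definitionally `1/tail (suc k) m`.
  tail : ℕ → ℕ → ℚ
  tail k = tailConvergent (λ i → entries (k + i)) (λ i → nonzero (k + i))

  1/tail : ℕ → ℕ → ℚ
  1/tail k m = (ℚ.1/ tail k m)
    {{tailConvergent-nonZero (λ i → entries (k + i)) (λ i → nonzero (k + i)) m}}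

  1/tail*tail : ∀ k m → 1/tail k m ℚ.* tail k m ≡ 1ℚ
  1/tail*tail k m = ℚ.*-inverseˡ (tail k m)
    {{tailConvergent-nonZero (λ i → entries (k + i)) (λ i → nonzero (k + i)) m}}

  2n≡n+n : ℕ→ℚ (2 * n) ≡ ℕ→ℚ n ℚ.+ ℕ→ℚ n
  2n≡n+n = trans (cong (λ m → ℕ→ℚ (n + m)) (ℕ.+-identityʳ n)) (ℕ→ℚ-homo-+ n n)

  -- entries (3 + i) computes to entries i, so tail 3 is definitionally tail 0.
  tail₂≡n+c : ∀ m → tail 2 m ≡ ℕ→ℚ n ℚ.+ c m
  tail₂≡n+c zero    = 2n≡n+n
  tail₂≡n+c (suc m) = trans (cong (ℚ._+ 1/tail 0 m) 2n≡n+n) (ℚ.+-assoc (ℕ→ℚ n) (ℕ→ℚ n) (1/tail 0 m))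

  -- One full period of the expansion: `tail 0 (2 + m)` unfolds through the entries `a` and `b` down
  -- to `tail 2 m`, which is n + c_m.
  möbius : ∀ m → 1/tail 0 (2 + m) ℚ.* ((ℕ→ℚ a ℚ.* ℕ→ℚ b ℚ.+ 1ℚ) ℚ.* (ℕ→ℚ n ℚ.+ c m) ℚ.+ ℕ→ℚ a)
                 ≡ ℕ→ℚ b ℚ.* (ℕ→ℚ n ℚ.+ c m) ℚ.+ 1ℚ
  möbius m = subst
    (λ t → 1/tail 0 (2 + m) ℚ.* ((ℕ→ℚ a ℚ.* ℕ→ℚ b ℚ.+ 1ℚ) ℚ.* t ℚ.+ ℕ→ℚ a) ≡ ℕ→ℚ b ℚ.* t ℚ.+ 1ℚ)
    (tail₂≡n+c m)
    (inverses⇒möbius {α = ℕ→ℚ a} {β = ℕ→ℚ b} {t = tail 2 m}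
      {p = 1/tail 2 m} {q = 1/tail 1 (1 + m)} {r = 1/tail 0 (2 + m)}
      (1/tail*tail 2 m) (1/tail*tail 1 (1 + m)) (1/tail*tail 0 (2 + m)))

  module _ (j : ℕ) (converges : ConvergesTo c (√ (n ^ 2 + j))) where

    N = n ^ 2 + j

    open Limit (ℕ→ℚ a) (ℕ→ℚ b) (ℕ→ℚ n) (ℕ→ℚ j)

    N≡M : ℕ→ℚ N ≡ M
    N≡M = trans (ℕ→ℚ-homo-+ (n ^ 2) j)
      (cong (ℚ._+ ℕ→ℚ j) (trans (cong (λ m → ℕ→ℚ (n * m)) (ℕ.*-identityʳ n)) (ℕ→ℚ-homo-* n n)))

    index : Tolerance → ℕ
    index t = proj₁ (converges (ε t) (0<ε t))

    near : ∀ t k → Near (√ N) (ε t) (c (k + index t))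
    near t k = proj₂ (converges (ε t) (0<ε t)) (k + index t) (ℕ.m≤n+m (index t) k)

    rational-limit : D ℚ.* D ℚ.* M ≡ E ℚ.* E
    rational-limit = D²M≡E² (c ∘ index) (λ t → 1/tail 0 (2 + index t))
      (NearSqrt.B N , λ t → NearSqrt.bound N t {c (index t)} (near t 0))
      (NearSqrt.K N , λ t → subst (λ x → ℚ.∣ c (index t) ℚ.* c (index t) ℚ.- x ∣ ℚ.≤ NearSqrt.K N ℚ.* ε t)
        N≡M (NearSqrt.square-bound N t {c (index t)} (near t 0)))
      -- Convergent `3 + index t` unfolds to n + `1/tail 0 (2 + index t)`, so the step ν + r - c
      -- compares two convergents that are both within ε of √N.
      (1ℚ ℚ.+ 1ℚ , λ t → near-near (√ N) {ε t} {c (3 + index t)} {c (index t)} (near t 3) (near t 0))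
      (λ t → möbius (index t))

    Dℤ Eℤ : ℤ
    Dℤ = + a ℤ.- + b
    Eℤ = + ((a * b + 1) * j) ℤ.- + ((a + b) * n + 1)

    D≡ : Dℤ ℚ./ 1 ≡ D
    D≡ = /1-homo-- (+ a) (+ b)

    E≡ : Eℤ ℚ./ 1 ≡ E
    E≡ = trans (/1-homo-- (+ ((a * b + 1) * j)) (+ ((a + b) * n + 1))) (cong₂ ℚ._-_
      (trans (ℕ→ℚ-homo-* (a * b + 1) j) (cong (ℚ._* ℕ→ℚ j)
        (trans (ℕ→ℚ-homo-+ (a * b) 1) (cong (ℚ._+ 1ℚ) (ℕ→ℚ-homo-* a b)))))
      (trans (ℕ→ℚ-homo-+ ((a + b) * n) 1) (cong (ℚ._+ 1ℚ)
        (trans (ℕ→ℚ-homo-* (a + b) n) (cong (ℚ._* ℕ→ℚ n) (ℕ→ℚ-homo-+ a b))))))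

    integer-limit : Dℤ ℤ.* Dℤ ℤ.* + N ≡ Eℤ ℤ.* Eℤ
    integer-limit = /1-injective (begin
      (Dℤ ℤ.* Dℤ ℤ.* + N) ℚ./ 1                          ≡⟨ /1-homo-* (Dℤ ℤ.* Dℤ) (+ N) ⟩
      ((Dℤ ℤ.* Dℤ) ℚ./ 1) ℚ.* ℕ→ℚ N                      ≡⟨ cong (ℚ._* ℕ→ℚ N) (/1-homo-* Dℤ Dℤ) ⟩
      ((Dℤ ℚ./ 1) ℚ.* (Dℤ ℚ./ 1)) ℚ.* ℕ→ℚ N              ≡⟨ cong₂ ℚ._*_ (cong₂ ℚ._*_ D≡ D≡) N≡M ⟩
      D ℚ.* D ℚ.* M                                      ≡⟨ rational-limit ⟩
      E ℚ.* E                                            ≡⟨ cong₂ ℚ._*_ E≡ E≡ ⟨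
      (Eℤ ℚ./ 1) ℚ.* (Eℤ ℚ./ 1)                          ≡⟨ /1-homo-* Eℤ Eℤ ⟨
      (Eℤ ℤ.* Eℤ) ℚ./ 1                                  ∎)
      where open ≡-Reasoning

    -- Absolute values discard the unknown signs of `Dℤ` and `Eℤ`, so that divisibility in ℕ
    -- applies.
    natural-limit : ℤ.∣ Dℤ ∣ * ℤ.∣ Dℤ ∣ * N ≡ ℤ.∣ Eℤ ∣ * ℤ.∣ Eℤ ∣
    natural-limit = begin
      ℤ.∣ Dℤ ∣ * ℤ.∣ Dℤ ∣ * N       ≡⟨ cong (_* N) (ℤ.abs-* Dℤ Dℤ) ⟨
      ℤ.∣ Dℤ ℤ.* Dℤ ∣ * N           ≡⟨ ℤ.abs-* (Dℤ ℤ.* Dℤ) (+ N) ⟨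
      ℤ.∣ Dℤ ℤ.* Dℤ ℤ.* + N ∣       ≡⟨ cong ℤ.∣_∣ integer-limit ⟩
      ℤ.∣ Eℤ ℤ.* Eℤ ∣               ≡⟨ ℤ.abs-* Eℤ Eℤ ⟩
      ℤ.∣ Eℤ ∣ * ℤ.∣ Eℤ ∣           ∎
      where open ≡-Reasoning

    module _ (¬square : ∀ r → ¬ (r * r ≡ N)) where

      ∣D∣≡0 : ℤ.∣ Dℤ ∣ ≡ 0
      ∣D∣≡0 = m²N≡n²⇒m≡0 {n = ℤ.∣ Eℤ ∣} ¬square natural-limit

      ∣E∣≡0 : ℤ.∣ Eℤ ∣ ≡ 0
      ∣E∣≡0 = reduce (ℕ.m*n≡0⇒m≡0∨n≡0 ℤ.∣ Eℤ ∣
        (trans (sym natural-limit) (cong (λ d → d * d * N) ∣D∣≡0)))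

      a≡b : a ≡ b
      a≡b = ℤ.+-injective (ℤ.i-j≡0⇒i≡j (+ a) (+ b) (ℤ.∣i∣≡0⇒i≡0 ∣D∣≡0))

      [ab+1]j≡[a+b]n+1 : (a * b + 1) * j ≡ (a + b) * n + 1
      [ab+1]j≡[a+b]n+1 = ℤ.+-injective (ℤ.i-j≡0⇒i≡j _ _ (ℤ.∣i∣≡0⇒i≡0 ∣E∣≡0))

-- Non-squareness of N and the parity conclusion

mainTheorem2 : (n j : ℕ) → 1 ≤ n → 1 ≤ j → j ≤ 2 * n →
    let N = n ^ 2 + j in
    HasPeriodOfLength n N 3 →
    ¬ (2 ∣ j) × (∃[ x ] 2 ∣ x × (√ N) ≐[ + n ⨾overline x ∷ x ∷ 2 * n ∷ [] ])
mainTheorem2 n j _ 1≤j j≤2n (a ∷ b ∷ [] , expansion) = palindromic a≡b expansion [ab+1]j≡[a+b]n+1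
  where
  open IsContinuedFractionOf expansion
  -- N lies strictly between consecutive squares: n² < n² + j ≤ n² + 2n < (n + 1)².
  ¬square : ∀ r → ¬ (r * r ≡ n ^ 2 + j)
  ¬square = ¬square-between {n}
    (subst (λ m → n * n < n * m + j) (sym (ℕ.*-identityʳ n)) (ℕ.m<m+n (n * n) 1≤j))
    (begin-strict
      n ^ 2 + j            ≤⟨ ℕ.+-monoʳ-≤ (n ^ 2) j≤2n ⟩
      n ^ 2 + 2 * n        <⟨ ℕ.n<1+n _ ⟩
      suc (n ^ 2 + 2 * n)  ≡⟨ solve 1 (λ n → con 1 :+ (n :^ 2 :+ con 2 :* n) := (con 1 :+ n) :* (con 1 :+ n)) refl n ⟩
      suc n * suc n        ∎)
    where
    open ℕ.≤-Reasoning
    open ℕSolver.+-*-Solver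
  a≡b = PeriodThree.a≡b n a b nonzero j converges ¬square
  [ab+1]j≡[a+b]n+1 = PeriodThree.[ab+1]j≡[a+b]n+1 n a b nonzero j converges ¬square
  -- Generalising over `b` lets the match on `refl` turn the given expansion itself into the
  -- palindromic one, with `a` as the witness.
  palindromic : ∀ {b} → a ≡ b → (√ (n ^ 2 + j)) ≐[ + n ⨾overline a ∷ b ∷ 2 * n ∷ [] ] →
    (a * b + 1) * j ≡ (a + b) * n + 1 →
    ¬ (2 ∣ j) × (∃[ x ] 2 ∣ x × (√ (n ^ 2 + j)) ≐[ + n ⨾overline x ∷ x ∷ 2 * n ∷ [] ])
  palindromic refl expansion eq =
    let (2∤j , 2∣a) = [a²+1]j≡2an+1⇒parity a j n (trans eq (cong (_+ 1)
          (trans (cong (λ x → (a + x) * n) (sym (ℕ.+-identityʳ a))) (ℕ.*-assoc 2 a n))))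
    in 2∤j , a , 2∣a , expansion
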